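{- Let $\varepsilon>0$ be a constant (with $3/2-\varepsilon\ge 1$). Any (probabilistic bounded error or deterministic) symbolic algorithm that computes a $(3/2-\varepsilon)$-approximation of the diameter of an undirected connected graph with $n$ vertices needs $\Omega(n)$ symbolic one-step operations.
   Context: Symbolic model: the input is a finite graph $G=(V,E)$, $n=|V|$; an undirected graph is regarded as a directed graph with symmetric edge relation. The algorithm knows $V$, but it can access $E$ only through the one-step operations $\mathrm{Pre}(S)=\{v\in V\mid \exists s\in S:(v,s)\in E\}$ and $\mathrm{Post}(S)=\{v\in V\mid \exists s\in S:(s,v)\in E\}$ (equal for undirected graphs) applied to (adaptively chosen) sets $S\subseteq V$. All other computation, in particular basic set operations on vertex sets, is unrestricted and not counted in lower bounds; any number of sets may be stored. A probabilistic bounded error algorithm may use random bits and must be correct with probability at least $2/3$ on every input. The diameter $D$ of $G$ is the maximum of the distance $d(u,v)$ over all pairs $u,v$ such that $u$ can reach $v$. A $c$-approximation of the diameter is an estimate $\widetilde D$ with $D/c\le\widetilde D\le D$. Convention for lower bounds: "needs $\Omega(n)$ one-step operations" means: there is a constant $c'>0$ such that every (deterministic or probabilistic bounded error) symbolic algorithm solving the problem on all inputs performs, on inputs with arbitrarily large $n$, at least $c'\cdot n$ one-step operations (worst case over its random choices). -}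

module Defs where

open import Algebra.Bundles using (CommutativeRing)
open import Data.Bool.Base using (Bool)
open import Data.Empty using (⊥-elim)
open import Data.Fin.Base using (Fin)
open import Data.Fin.Properties using (any?)
open import Data.Fin.Subset using (Subset; _∈_)
open import Data.Fin.Subset.Properties using (_∈?_)
open import Data.Integer.Base using (+_)
open import Data.List.Base using (List; []; _∷_; length)
open import Data.List.Relation.Unary.All using (All)
open import Data.List.Relation.Unary.Unique.Propositional using (Unique)
open import Data.Maybe.Base using (Maybe; just; nothing)
open import Data.Nat.Base as ℕ using (ℕ; zero; suc)
open import Data.Product.Base using (_×_; _,_; ∃; ∃-syntax; Σ-syntax)
open import Data.Rational.Base as ℚ using (ℚ; 0ℚ)
open import Data.Rational.Properties as ℚ
  using (+-*-commutativeRing; <-isStrictPartialOrder; <-cmp)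
open import Data.Sum.Base using (_⊎_; inj₁; inj₂)
open import Data.Vec.Base using (Vec; []; _∷_; tabulate)
open import Level using (Level; 0ℓ) renaming (suc to lsuc; _⊔_ to _⊔ˡ_)
open import Relation.Binary.Core using (Rel)
open import Relation.Binary.Definitions
  using (Decidable; Symmetric; Cotransitive; tri<; tri≈; tri>)
open import Relation.Binary.PropositionalEquality using (_≡_; _≢_; refl)
open import Relation.Binary.Structures using (IsStrictPartialOrder)
open import Relation.Nullary.Decidable using (does; _×-dec_)
open import Relation.Nullary.Negation using (¬_)

import Algebra.Definitions.RawMonoid as RawMonoidMult

------------------------------------------------------------------------
-- Numbers

-- The library has no real numbers.  ε, the approximation ratio and the
-- estimates range over an arbitrary ordered field.  The axioms are the
-- constructive ones (comparison instead of trichotomy, inverses of positive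
-- elements), so that the constructive reals are an instance and not only ℚ.

record OrderedField (c ℓ₁ ℓ₂ : Level) : Set (lsuc (c ⊔ˡ ℓ₁ ⊔ˡ ℓ₂)) where
  field
    commutativeRing : CommutativeRing c ℓ₁

  open CommutativeRing commutativeRing public

  infix 4 _<_ _≤_

  field
    _<_                  : Rel Carrier ℓ₂
    isStrictPartialOrder : IsStrictPartialOrder _≈_ _<_
    <-cotrans            : Cotransitive _<_
    <-tight              : ∀ x y → ¬ x < y → ¬ y < x → x ≈ y
    0<1                  : 0# < 1#
    +-monoˡ-<            : ∀ z {x y} → x < y → x + z < y + z
    *-pos                : ∀ {x y} → 0# < x → 0# < y → 0# < x * y
    inverse              : ∀ x → 0# < x → Carrier
    *-inverseʳ           : ∀ x (0<x : 0# < x) → x * inverse x 0<x ≈ 1#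

  module <-SPO = IsStrictPartialOrder isStrictPartialOrder

  _≤_ : Rel Carrier ℓ₂
  x ≤ y = ¬ y < x

  open RawMonoidMult +-rawMonoid using () renaming (_×_ to _·_)

  fromℕ : ℕ → Carrier
  fromℕ n = n · 1#

  divide : ∀ x y → 0# < y → Carrier
  divide x y 0<y = x * inverse y 0<y

  ≥1⇒>0 : ∀ {x} → 1# ≤ x → 0# < x
  ≥1⇒>0 {x} 1≤x with <-cotrans 0<1 x
  ... | inj₁ 0<x = 0<x
  ... | inj₂ x<1 = ⊥-elim (1≤x x<1)

  0<fromℕ-suc : ∀ n → 0# < fromℕ (suc n)
  0<fromℕ-suc zero    = <-SPO.<-respʳ-≈ (sym (+-identityʳ 1#)) 0<1
  0<fromℕ-suc (suc n) = <-SPO.trans (0<fromℕ-suc n)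
    (<-SPO.<-respˡ-≈ (+-identityˡ _) (+-monoˡ-< (fromℕ (suc n)) 0<1))

  3/2 : Carrier
  3/2 = divide (fromℕ 3) (fromℕ 2) (0<fromℕ-suc 1)

  IsApproximation : (ρ : Carrier) → 1# ≤ ρ → (D : ℕ) → Carrier → Set ℓ₂
  IsApproximation ρ 1≤ρ D D̃ =
    divide (fromℕ D) ρ (≥1⇒>0 1≤ρ) ≤ D̃ × D̃ ≤ fromℕ D

ℚ-orderedField : OrderedField 0ℓ 0ℓ 0ℓ
ℚ-orderedField = record
  { commutativeRing      = +-*-commutativeRing
  ; _<_                  = ℚ._<_
  ; isStrictPartialOrder = <-isStrictPartialOrder
  ; <-cotrans            = cotrans
  ; <-tight              = tight
  ; 0<1                  = ℚ.positive⁻¹ ℚ.1ℚ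
  ; +-monoˡ-<            = λ z → ℚ.+-monoˡ-< z
  ; *-pos                = λ {x} {y} 0<x 0<y →
      ℚ.positive⁻¹ (x ℚ.* y)
        {{ℚ.pos*pos⇒pos x {{ℚ.positive 0<x}} y {{ℚ.positive 0<y}}}}
  ; inverse              = λ x 0<x → (ℚ.1/ x) {{ℚ.pos⇒nonZero x {{ℚ.positive 0<x}}}}
  ; *-inverseʳ           = λ x 0<x →
      ℚ.*-inverseʳ x {{ℚ.pos⇒nonZero x {{ℚ.positive 0<x}}}}
  }
  where
  cotrans : Cotransitive ℚ._<_
  cotrans {x} {y} x<y z with <-cmp x z
  ... | tri< x<z _ _    = inj₁ x<z
  ... | tri≈ _ refl _   = inj₂ x<y
  ... | tri> _ _ z<x    = inj₂ (ℚ.<-trans z<x x<y)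

  tight : ∀ x y → ¬ x ℚ.< y → ¬ y ℚ.< x → x ≡ y
  tight x y x≮y y≮x with <-cmp x y
  ... | tri< x<y _ _ = ⊥-elim (x≮y x<y)
  ... | tri≈ _ x≡y _ = x≡y
  ... | tri> _ _ y<x = ⊥-elim (y≮x y<x)

fromℕℚ : ℕ → ℚ
fromℕℚ n = + n ℚ./ 1

------------------------------------------------------------------------
-- Graphs

record Graph (n : ℕ) : Set₁ where
  field
    E  : Rel (Fin n) 0ℓ
    E? : Decidable E

open Graph public

Undirected : ∀ {n} → Graph n → Set
Undirected G = Symmetric (E G)

data Walk {n} (G : Graph n) : ℕ → Rel (Fin n) 0ℓ where
  done : ∀ {u} → Walk G 0 u u
  step : ∀ {k u v w} → E G u v → Walk G k v w → Walk G (suc k) u w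

Connected : ∀ {n} → Graph n → Set
Connected G = ∀ u v → ∃[ k ] Walk G k u v

IsDistance : ∀ {n} → Graph n → (u v : Fin n) → ℕ → Set
IsDistance G u v d = Walk G d u v × (∀ k → Walk G k u v → d ℕ.≤ k)

-- A pair that is not reachable has no distance, so the maximum is over
-- reachable pairs only.
IsDiameter : ∀ {n} → Graph n → ℕ → Set
IsDiameter G D =
  (∃[ u ] ∃[ v ] IsDistance G u v D) ×
  (∀ u v d → IsDistance G u v d → d ℕ.≤ D)

Pre : ∀ {n} → Graph n → Subset n → Subset n
Pre G S = tabulate λ v → does (any? λ s → (s ∈? S) ×-dec E? G v s)

Post : ∀ {n} → Graph n → Subset n → Subset n
Post G S = tabulate λ v → does (any? λ s → (s ∈? S) ×-dec E? G s v)

------------------------------------------------------------------------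
-- Symbolic algorithms

data Request (n : ℕ) : Set where
  pre post : Subset n → Request n
  toss     : Request n

data Action {o} (Out : Set o) (n : ℕ) : Set o where
  halt : Out → Action Out n
  ask  : Request n → Action Out n

-- The answers received so far, latest first: results of one-step operations
-- and random bits.
History : ℕ → Set
History n = List (Subset n ⊎ Bool)

-- An algorithm may depend on V = Fin n, and it sees E only through its history.
-- What it does between two requests is an arbitrary function of the history,
-- hence unrestricted and free of charge, with unlimited storage.  It may toss
-- arbitrarily often and need not halt.
Algorithm : ∀ {o} → Set o → Set o
Algorithm Out = ∀ n → History n → Action Out n

answer : ∀ {n} → Graph n → Bool → Request n → Subset n ⊎ Bool
answer G b (pre S)  = inj₁ (Pre G S)
answer G b (post S) = inj₁ (Post G S)
answer G b toss     = inj₂ b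

cost : ∀ {n} → Request n → ℕ
cost (pre _)  = 1
cost (post _) = 1
cost toss     = 0

module _ {o} {Out : Set o} (A : Algorithm Out) {n} (G : Graph n) where

  -- A run of k steps is driven by k random bits.  Step i has bit i reserved for
  -- it and ignores it unless it is a toss; the bits actually read are
  -- therefore independent and uniform.

  outputFrom : ∀ {k} → History n → Vec Bool k → Maybe Out
  outputFrom h bs with A n h
  outputFrom h bs       | halt x = just x
  outputFrom h []       | ask r  = nothing
  outputFrom h (b ∷ bs) | ask r  = outputFrom (answer G b r ∷ h) bs

  oneStepOpsFrom : ∀ {k} → History n → Vec Bool k → ℕ
  oneStepOpsFrom h []       = 0
  oneStepOpsFrom h (b ∷ bs) with A n h
  ... | halt x = 0
  ... | ask r  = cost r ℕ.+ oneStepOpsFrom (answer G b r ∷ h) bs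

  output : ∀ {k} → Vec Bool k → Maybe Out
  output = outputFrom []

  oneStepOps : ∀ {k} → Vec Bool k → ℕ
  oneStepOps = oneStepOpsFrom []

-- For k uniform random bits, P has probability at least p.  The event P need
-- not be decidable, so its outcomes are exhibited as a duplicate-free list.
Probability≥ : ∀ {ℓ} (k : ℕ) → ℚ → (Vec Bool k → Set ℓ) → Set ℓ
Probability≥ k p P =
  Σ[ bss ∈ List (Vec Bool k) ]
    Unique bss × All P bss × p ℚ.* fromℕℚ (2 ℕ.^ k) ℚ.≤ fromℕℚ (length bss)

Deterministic : ∀ {o} {Out : Set o} → Algorithm Out → Set o
Deterministic A = ∀ n h → A n h ≢ ask toss

module _ {c ℓ₁ ℓ₂} (R : OrderedField c ℓ₁ ℓ₂) where
  open OrderedField R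

  -- The graph without vertices has no diameter; nothing is required there.
  Correct : (ρ : Carrier) → 1# ≤ ρ → ∀ {n} → Graph n → Maybe Carrier → Set (c ⊔ˡ ℓ₂)
  Correct ρ 1≤ρ G out =
    ∃[ D̃ ] out ≡ just D̃ × (∀ D → IsDiameter G D → IsApproximation ρ 1≤ρ D D̃)

  module _ (ρ : Carrier) (1≤ρ : 1# ≤ ρ) (A : Algorithm Carrier) where

    AlwaysCorrectOn : ∀ {n} → Graph n → Set (c ⊔ˡ ℓ₂)
    AlwaysCorrectOn G =
      ∃[ k ] ((bs : Vec Bool k) → Correct ρ 1≤ρ G (output A G bs))

    -- The probability of having halted with a correct output within k steps is
    -- nondecreasing in k, and its limit is the probability of being correct;
    -- the limit is at least 2/3.
    BoundedErrorOn : ∀ {n} → Graph n → Set (c ⊔ˡ ℓ₂)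
    BoundedErrorOn G =
      ∀ δ → 0ℚ ℚ.< δ → ∃[ K ] (∀ k → K ℕ.≤ k →
        Probability≥ k (+ 2 ℚ./ 3 ℚ.- δ) (λ bs → Correct ρ 1≤ρ G (output A G bs)))

    ApproximatesDiameter : Set (lsuc 0ℓ ⊔ˡ c ⊔ˡ ℓ₂)
    ApproximatesDiameter =
      (Deterministic A ×
        (∀ n (G : Graph n) → Undirected G → Connected G → AlwaysCorrectOn G))
      ⊎
      (∀ n (G : Graph n) → Undirected G → Connected G → BoundedErrorOn G)

{-# OPTIONS --safe #-}
module Submission where

-- The complete graph on m + 1 vertices, with loops, has diameter 1.  Deleting
-- the i-th edge {i, i + 1} of a Hamiltonian path makes it 2, and since the ratio
-- is below 2, no estimate is acceptable for both graphs.  A query to S is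
-- answered differently on the two graphs only if S is {i} or {i + 1}, so each
-- query separates the complete graph from at most two of the m others.  By
-- bounded error, for each i at least a quarter of the random strings lead to a
-- separating query on the complete graph; averaging over the strings yields one
-- whose run makes at least m / 8 queries.

open import Defs
import Algebra.Properties.AbelianGroup as AbelianGroupProperties
import Algebra.Properties.CommutativeMonoid.Sum as CommutativeMonoidSum
import Algebra.Properties.Ring as RingProperties
import Algebra.Properties.Semiring.Mult as SemiringMult
import Data.Bool.Properties as Bool
open import Data.Bool.Base using (Bool; true; false)
open import Data.Empty using (⊥-elim)
open import Data.Fin.Base using (Fin; zero; suc; inject₁)
open import Data.Fin.Properties as Fin using (any?; inject₁-injective; suc-injective)
open import Data.Fin.Subset using (Subset; ⁅_⁆; _∈_)
open import Data.Fin.Subset.Properties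
  using (_∈?_; x∈⁅x⁆; x∈⁅y⁆⇒x≡y; ⊆-antisym)
open import Data.Integer.Base as ℤ using (+_)
import Data.Integer.Properties as ℤ
open import Data.List.Base using (List; []; _∷_; length)
import Data.List.Membership.DecPropositional as DecMembership
open import Data.List.Relation.Unary.All as All using (All)
open import Data.List.Relation.Unary.All.Properties using (All¬⇒¬Any)
open import Data.List.Relation.Unary.AllPairs using ([]; _∷_)
open import Data.List.Relation.Unary.Any using (Any; here; there)
open import Data.List.Relation.Unary.Unique.Propositional using (Unique)
open import Data.Maybe.Base using (Maybe; just; nothing)
open import Data.Nat.Base as ℕ using (ℕ; zero; suc; _+_; _*_; _^_; z≤n; s≤s)
open import Data.Nat.Properties as ℕ
  using (≤-refl; ≤-trans; ≤-reflexive; +-mono-≤; *-monoʳ-≤; *-monoˡ-≤)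
open import Data.Nat.Solver using (module +-*-Solver)
open import Data.Product.Base using (_×_; _,_; ∃-syntax; Σ-syntax; proj₁; proj₂)
open import Data.Rational.Base as ℚ using (ℚ; 0ℚ)
import Data.Rational.Properties as ℚ
import Data.Rational.Unnormalised.Base as ℚᵘ
import Data.Rational.Unnormalised.Properties as ℚᵘ
open import Data.Sum.Base using (_⊎_; inj₁; inj₂; [_,_]′)
open import Data.Unit.Base using (⊤; tt)
open import Data.Vec.Base using (Vec; []; _∷_; truncate)
open import Data.Vec.Properties using (≡-dec; tabulate-cong)
open import Function.Base using (_∘_; id; const)
open import Function.Bundles using (mk⇔)
open import Level using (Level)
open import Relation.Binary.PropositionalEquality
  using (_≡_; _≢_; refl; sym; trans; cong; cong₂; subst; subst₂)
open import Relation.Nullary.Decidable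
  using (Dec; yes; no; does-⇔; ¬?; _×-dec_; _⊎-dec_)
open import Relation.Nullary.Negation using (¬_; contradiction)

open CommutativeMonoidSum ℕ.+-0-commutativeMonoid using (sum; ∑-distrib-+; sum-replicate-zero)

private
  variable
    p : Level
    k m n : ℕ

-- Ordered fields

module OrderedFieldProperties {c ℓ₁ ℓ₂} (R : OrderedField c ℓ₁ ℓ₂) where
  open OrderedField R renaming (_+_ to infixl 6 _⊕_; _*_ to infixl 7 _⊛_)
  private
    module F = OrderedField R
    module RP = RingProperties F.ring
    module SM = SemiringMult F.semiring

  <-resp : ∀ {x x′ y y′} → x ≈ x′ → y ≈ y′ → x F.< y → x′ F.< y′
  <-resp x≈x′ y≈y′ = <-SPO.<-respˡ-≈ x≈x′ ∘ <-SPO.<-respʳ-≈ y≈y′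

  x<y⇒0<y-x : ∀ {x y} → x F.< y → 0# F.< y - x
  x<y⇒0<y-x {x} x<y = <-resp (-‿inverseʳ x) F.refl (+-monoˡ-< (- x) x<y)

  0<y-x⇒x<y : ∀ {x y} → 0# F.< y - x → x F.< y
  0<y-x⇒x<y {x} {y} 0<y-x =
    <-resp (F.+-identityˡ x) y-x+x≈y (+-monoˡ-< x 0<y-x)
    where
    y-x+x≈y : (y - x) ⊕ x ≈ y
    y-x+x≈y = F.trans (F.+-assoc y (- x) x)
      (F.trans (F.+-congˡ (-‿inverseˡ x)) (F.+-identityʳ y))

  *-monoˡ-< : ∀ {x y z} → 0# F.< z → x F.< y → x ⊛ z F.< y ⊛ z
  *-monoˡ-< {x} {y} {z} 0<z x<y =
    0<y-x⇒x<y (<-resp F.refl difference (*-pos (x<y⇒0<y-x x<y) 0<z))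
    where
    difference : (y - x) ⊛ z ≈ y ⊛ z - x ⊛ z
    difference = F.trans (F.distribʳ z y (- x))
      (F.+-congˡ (F.sym (RP.-‿distribˡ-* x z)))

  -- Without trichotomy the conclusion holds only up to double negation.
  ¬¬0<inverse : ∀ {x} (0<x : 0# F.< x) → ¬ ¬ 0# F.< inverse x 0<x
  ¬¬0<inverse {x} 0<x 0≮y = <-SPO.irrefl 0≈1 0<1
    where
    y = inverse x 0<x

    y≮0 : ¬ y F.< 0#
    y≮0 y<0 = <-SPO.asym 0<1 (<-resp
      (F.trans (F.*-comm y x) (*-inverseʳ x 0<x)) (F.zeroˡ x) (*-monoˡ-< 0<x y<0))

    0≈1 : 0# ≈ 1#
    0≈1 = F.trans (F.sym (F.zeroʳ x))
      (F.trans (F.*-congˡ (<-tight 0# y 0≮y y≮0)) (*-inverseʳ x 0<x))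

  fromℕ-<-suc : ∀ n → fromℕ n F.< fromℕ (suc n)
  fromℕ-<-suc n = <-resp (F.+-identityˡ _) F.refl (+-monoˡ-< (fromℕ n) 0<1)

  -- Doubling `2 < 3/2` would give `4 < 3`.
  3/2≤2 : 3/2 F.≤ fromℕ 2
  3/2≤2 2<3/2 = <-SPO.asym (fromℕ-<-suc 3) (<-resp
    (F.sym (SM.×1-homo-* 2 2)) 3/2*2≈3 (*-monoˡ-< (0<fromℕ-suc 1) 2<3/2))
    where
    3/2*2≈3 : 3/2 ⊛ fromℕ 2 ≈ fromℕ 3
    3/2*2≈3 = F.trans (F.*-assoc _ _ _) (F.trans
      (F.*-congˡ (F.trans (F.*-comm _ _) (*-inverseʳ _ _))) (F.*-identityʳ _))

  -- By cotransitivity, `2` lies above `3/2 - ε` or below `3/2`; the latter contradicts `3/2≤2`.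
  3/2-ε<2 : ∀ {ε} → 0# F.< ε → 3/2 - ε F.< fromℕ 2
  3/2-ε<2 {ε} 0<ε = [ id , ⊥-elim ∘ 3/2≤2 ]′ (<-cotrans 3/2-ε<3/2 (fromℕ 2))
    where
    3/2-ε<3/2 : 3/2 - ε F.< 3/2
    3/2-ε<3/2 = <-resp (F.+-identityˡ _)
      (F.trans (F.sym (F.+-assoc _ _ _))
        (AbelianGroupProperties.xyx⁻¹≈y F.+-abelianGroup ε 3/2))
      (+-monoˡ-< (3/2 - ε) 0<ε)

  diameters-1-2-separated : ∀ {ρ} (1≤ρ : 1# F.≤ ρ) → ρ F.< fromℕ 2 → ∀ {D̃} →
    IsApproximation ρ 1≤ρ 1 D̃ → ¬ IsApproximation ρ 1≤ρ 2 D̃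
  diameters-1-2-separated {ρ} 1≤ρ ρ<2 {D̃} (_ , D̃≤1) (2/ρ≤D̃ , _) =
    -- The goal is a negation, so doubly negated positivity of the inverse suffices. It yields
    -- `1 < 2/ρ`, and then `D̃` is above 1 or below `2/ρ`; each contradicts one of the two
    -- approximations.
    ¬¬0<inverse 0<ρ λ 0<ρ⁻¹ →
      [ D̃≤1 ∘ <-resp (F.sym (F.+-identityʳ 1#)) F.refl , 2/ρ≤D̃ ]′
        (<-cotrans (<-resp (*-inverseʳ ρ 0<ρ) F.refl (*-monoˡ-< 0<ρ⁻¹ ρ<2)) D̃)
    where
    0<ρ = ≥1⇒>0 1≤ρ

-- Rational inequalities between naturals

private
  -- Exposes numerator and denominator of the product, so that an inequality of rationals becomes a
  -- cross-multiplied one.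
  toℚᵘ-scaled : ∀ a b x →
    ℚ.toℚᵘ ((+ a ℚ./ suc b) ℚ.* fromℕℚ x) ℚᵘ.≃ ℚᵘ.mkℚᵘ (+ (a * x)) b
  toℚᵘ-scaled a b x = ℚᵘ.≃-trans (ℚ.toℚᵘ-homo-* (+ a ℚ./ suc b) (fromℕℚ x))
    (ℚᵘ.≃-trans
      (ℚᵘ.*-cong (ℚ.toℚᵘ-fromℚᵘ (ℚᵘ.mkℚᵘ (+ a) b)) (toℚᵘ-fromℕℚ x))
      (ℚᵘ.*≡* (cong₂ ℤ._*_ (sym (ℤ.pos-* a x))
        (cong (+_ ∘ suc) (sym (ℕ.*-identityʳ b))))))
    where
    toℚᵘ-fromℕℚ : ∀ x → ℚ.toℚᵘ (fromℕℚ x) ℚᵘ.≃ ℚᵘ.mkℚᵘ (+ x) 0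
    toℚᵘ-fromℕℚ x = ℚ.toℚᵘ-fromℚᵘ (ℚᵘ.mkℚᵘ (+ x) 0)

/*≤⇒*≤* : ∀ a b x y → (+ a ℚ./ suc b) ℚ.* fromℕℚ x ℚ.≤ fromℕℚ y → a * x ℕ.≤ suc b * y
/*≤⇒*≤* a b x y le = subst (ℕ._≤ suc b * y) (ℕ.*-identityʳ (a * x))
  (subst (a * x * 1 ℕ.≤_) (ℕ.*-comm y (suc b)) (ℤ.drop‿+≤+
    (subst₂ ℤ._≤_ (sym (ℤ.pos-* (a * x) 1)) (sym (ℤ.pos-* y (suc b)))
      (ℚᵘ.drop-*≤* (ℚᵘ.≤-respˡ-≃ (toℚᵘ-scaled a b x)
        (ℚᵘ.≤-respʳ-≃ (ℚ.toℚᵘ-fromℚᵘ (ℚᵘ.mkℚᵘ (+ y) 0)) (ℚ.toℚᵘ-mono-≤ le)))))))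

*≤*⇒/*≤ : ∀ a b x y → a * x ℕ.≤ suc b * y → (+ a ℚ./ suc b) ℚ.* fromℕℚ x ℚ.≤ fromℕℚ y
*≤*⇒/*≤ a b x y le = ℚ.toℚᵘ-cancel-≤
  (ℚᵘ.≤-respˡ-≃ (ℚᵘ.≃-sym (toℚᵘ-scaled a b x))
    (ℚᵘ.≤-respʳ-≃ (ℚᵘ.≃-sym (ℚ.toℚᵘ-fromℚᵘ (ℚᵘ.mkℚᵘ (+ y) 0))) (ℚᵘ.*≤*
      (subst₂ ℤ._≤_ (ℤ.pos-* (a * x) 1) (ℤ.pos-* y (suc b)) (ℤ.+≤+
        (subst (ℕ._≤ y * suc b) (sym (ℕ.*-identityʳ (a * x)))
          (subst (a * x ℕ.≤_) (ℕ.*-comm (suc b) y) le)))))))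

-- Finite sums and counting

indicator : {P : Set p} → Dec P → ℕ
indicator (yes _) = 1
indicator (no _)  = 0

-- Indicator for a possibly undecidable event: `just` marks the outcomes at which a proof is at
-- hand.
occupied : {P : Set p} → Maybe P → ℕ
occupied (just _) = 1
occupied nothing  = 0

indicator≡0⇒¬ : {P : Set p} (P? : Dec P) → indicator P? ≡ 0 → ¬ P
indicator≡0⇒¬ (no ¬p) _ = ¬p

sum-indicator≤1 : {P : Fin m → Set p} (P? : ∀ i → Dec (P i)) →
  (∀ i j → P i → P j → i ≡ j) → sum (indicator ∘ P?) ℕ.≤ 1
sum-indicator≤1 {m = zero}  P? unique = z≤n
sum-indicator≤1 {m = suc m} P? unique with P? zero
... | no _   = sum-indicator≤1 (P? ∘ suc) λ i j pi pj → suc-injective (unique _ _ pi pj)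
... | yes p₀ = s≤s (≤-reflexive (sum≡0 (P? ∘ suc) λ i pi → 0≢suc (unique _ _ p₀ pi)))
  where
  0≢suc : ∀ {i : Fin m} → zero ≢ suc i
  0≢suc ()

  sum≡0 : ∀ {n q} {Q : Fin n → Set q} (Q? : ∀ i → Dec (Q i)) →
    (∀ i → ¬ Q i) → sum (indicator ∘ Q?) ≡ 0
  sum≡0 {zero}  Q? ¬Q = refl
  sum≡0 {suc n} Q? ¬Q with Q? zero
  ... | yes q₀ = contradiction q₀ (¬Q zero)
  ... | no _   = sum≡0 (Q? ∘ suc) (¬Q ∘ suc)

sum-bounded-below : ∀ c d (f : Fin m → ℕ) → (∀ i → c ℕ.≤ d * f i) → m * c ℕ.≤ d * sum f
sum-bounded-below {zero}  c d f le = z≤n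
sum-bounded-below {suc m} c d f le = ≤-trans
  (+-mono-≤ (le zero) (sum-bounded-below c d (f ∘ suc) (le ∘ suc)))
  (≤-reflexive (sym (ℕ.*-distribˡ-+ d (f zero) (sum (f ∘ suc)))))

-- This is `2 ^ k` times the expectation over uniform bits, which keeps the probabilistic argument
-- within the naturals.
∑ : (Vec Bool k → ℕ) → ℕ
∑ {zero}  f = f []
∑ {suc k} f = ∑ (f ∘ (true ∷_)) + ∑ (f ∘ (false ∷_))

∑-mono : {f g : Vec Bool k → ℕ} → (∀ bs → f bs ℕ.≤ g bs) → ∑ f ℕ.≤ ∑ g
∑-mono {zero}  f≤g = f≤g []
∑-mono {suc k} f≤g = +-mono-≤ (∑-mono (f≤g ∘ (true ∷_))) (∑-mono (f≤g ∘ (false ∷_)))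

private
  interchange : ∀ a b c d → (a + b) + (c + d) ≡ (a + c) + (b + d)
  interchange = solve 4
    (λ a b c d → (a :+ b) :+ (c :+ d) := (a :+ c) :+ (b :+ d)) refl
    where open +-*-Solver

∑-+ : (f g : Vec Bool k → ℕ) → ∑ (λ bs → f bs + g bs) ≡ ∑ f + ∑ g
∑-+ {zero}  f g = refl
∑-+ {suc k} f g = trans
  (cong₂ _+_ (∑-+ (f ∘ (true ∷_)) (g ∘ (true ∷_)))
             (∑-+ (f ∘ (false ∷_)) (g ∘ (false ∷_))))
  (interchange (∑ (f ∘ (true ∷_))) _ _ _)

∑-* : ∀ c (f : Vec Bool k → ℕ) → ∑ (λ bs → c * f bs) ≡ c * ∑ f
∑-* {zero}  c f = refl
∑-* {suc k} c f = trans
  (cong₂ _+_ (∑-* c (f ∘ (true ∷_))) (∑-* c (f ∘ (false ∷_))))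
  (sym (ℕ.*-distribˡ-+ c _ _))

∑-const1 : ∀ k → ∑ {k} (const 1) ≡ 2 ^ k
∑-const1 zero    = refl
∑-const1 (suc k) =
  cong₂ _+_ (∑-const1 k) (trans (∑-const1 k) (sym (ℕ.+-identityʳ (2 ^ k))))

term≤∑ : (f : Vec Bool k → ℕ) (bs : Vec Bool k) → f bs ℕ.≤ ∑ f
term≤∑ f []           = ≤-refl
term≤∑ f (true  ∷ bs) = ≤-trans (term≤∑ (f ∘ (true ∷_)) bs) (ℕ.m≤m+n _ _)
term≤∑ f (false ∷ bs) = ≤-trans (term≤∑ (f ∘ (false ∷_)) bs) (ℕ.m≤n+m _ _)

sum-∑-comm : (f : Fin m → Vec Bool k → ℕ) →
  sum (λ i → ∑ (f i)) ≡ ∑ (λ bs → sum (λ i → f i bs))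
sum-∑-comm {k = zero}  f = refl
sum-∑-comm {k = suc k} f = trans
  (∑-distrib-+ (λ i → ∑ (f i ∘ (true ∷_))) (λ i → ∑ (f i ∘ (false ∷_))))
  (cong₂ _+_ (sum-∑-comm (λ i → f i ∘ (true ∷_)))
             (sum-∑-comm (λ i → f i ∘ (false ∷_))))

-- If both halves of the cube fell below their share `m * 2 ^ k`, so would the whole. Hence some
-- value of the first bit leads to a half with the same average bound, and the bits are fixed one at
-- a time.
averaging : ∀ m c (f : Vec Bool k → ℕ) → m * 2 ^ k ℕ.≤ c * ∑ f →
  ∃[ bs ] m ℕ.≤ c * f bs
averaging {zero}  m c f le = [] , subst (ℕ._≤ c * f []) (ℕ.*-identityʳ m) le
averaging {suc k} m c f le =
  [ (λ le₁ → let bs , p = averaging m c f₁ le₁ in true ∷ bs , p)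
  , (λ le₂ → let bs , p = averaging m c f₂ le₂ in false ∷ bs , p)
  ]′ (split (subst₂ ℕ._≤_ m*2^[1+k]≡ (ℕ.*-distribˡ-+ c (∑ f₁) (∑ f₂)) le))
  where
  f₁ = f ∘ (true ∷_)
  f₂ = f ∘ (false ∷_)

  m*2^[1+k]≡ : m * 2 ^ suc k ≡ m * 2 ^ k + m * 2 ^ k
  m*2^[1+k]≡ = solve 2 (λ m t → m :* (con 2 :* t) := m :* t :+ m :* t) refl m (2 ^ k)
    where open +-*-Solver

  split : ∀ {x y z} → x + x ℕ.≤ y + z → x ℕ.≤ y ⊎ x ℕ.≤ z
  split {x} {y} {z} le with x ℕ.≤? y | x ℕ.≤? z
  ... | yes x≤y | _       = inj₁ x≤y
  ... | no  _   | yes x≤z = inj₂ x≤z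
  ... | no  x≰y | no x≰z  =
    contradiction le (ℕ.<⇒≱ (ℕ.+-mono-< (ℕ.≰⇒> x≰y) (ℕ.≰⇒> x≰z)))

infix 4 _≟ᵛ_ _∈ᵛ?_

_≟ᵛ_ : (bs cs : Vec Bool k) → Dec (bs ≡ cs)
_≟ᵛ_ = ≡-dec Bool._≟_

_∈ᵛ?_ : ∀ (bs : Vec Bool k) bss → Dec (Any (bs ≡_) bss)
_∈ᵛ?_ = DecMembership._∈?_ _≟ᵛ_

-- Each entry contributes a one at its own string, and in a list without duplicates the head and the
-- tail never contribute at the same string.
length≤∑∈ : (bss : List (Vec Bool k)) → Unique bss →
  length bss ℕ.≤ ∑ (λ bs → indicator (bs ∈ᵛ? bss))
length≤∑∈ []         _           = z≤n
length≤∑∈ (cs ∷ css) (cs∉ ∷ css!) = ≤-trans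
  (+-mono-≤ (≤-trans (≤-reflexive (sym cs≟cs)) (term≤∑ _ cs)) (length≤∑∈ css css!))
  (≤-trans (≤-reflexive (sym (∑-+ (λ bs → indicator (bs ≟ᵛ cs)) _))) (∑-mono pointwise))
  where
  cs≟cs : indicator (cs ≟ᵛ cs) ≡ 1
  cs≟cs with cs ≟ᵛ cs
  ... | yes _  = refl
  ... | no cs≢ = contradiction refl cs≢

  pointwise : ∀ bs →
    indicator (bs ≟ᵛ cs) + indicator (bs ∈ᵛ? css) ℕ.≤ indicator (bs ∈ᵛ? (cs ∷ css))
  pointwise bs with bs ≟ᵛ cs | bs ∈ᵛ? css | bs ∈ᵛ? (cs ∷ css)
  ... | yes refl | yes cs∈ | _       = contradiction cs∈ (All¬⇒¬Any cs∉)
  ... | yes refl | no _    | yes _   = ≤-refl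
  ... | yes refl | no _    | no cs∉′ = contradiction (here refl) cs∉′
  ... | no _     | yes _   | yes _   = ≤-refl
  ... | no _     | yes bs∈ | no bs∉′ = contradiction (there bs∈) bs∉′
  ... | no _     | no _    | _       = z≤n

-- Provides a run length that suffices for finitely many graphs at once.
upper-bound : (f : Fin m → ℕ) → ∃[ K ] (∀ i → f i ℕ.≤ K)
upper-bound {zero}  f = 0 , λ ()
upper-bound {suc m} f with upper-bound (f ∘ suc)
... | K , f≤K = f zero ℕ.⊔ K , λ where
  zero    → ℕ.m≤m⊔n (f zero) K
  (suc i) → ≤-trans (f≤K i) (ℕ.m≤n⊔m (f zero) K)

-- Symbolic algorithms

-- An event of probability at least 5/8 = 2/3 - 1/24.
Likely : (k : ℕ) → (Vec Bool k → Set p) → Set p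
Likely k P = Σ[ event ∈ (∀ bs → Maybe (P bs)) ] 5 * 2 ^ k ℕ.≤ 8 * ∑ (occupied ∘ event)

always⇒likely : {P : Vec Bool k → Set p} → (∀ bs → P bs) → Likely k P
always⇒likely {k} P! = just ∘ P! ,
  subst (λ t → 5 * 2 ^ k ℕ.≤ 8 * t) (sym (∑-const1 k))
    (*-monoˡ-≤ (2 ^ k) {5} {8} (ℕ.m≤m+n 5 3))

-- Membership in the exhibited list is decidable even if `P` is not, so it can serve as the event.
probability⇒likely : {P : Vec Bool k → Set p} →
  Probability≥ k (+ 5 ℚ./ 8) P → Likely k P
probability⇒likely {k} {P = P} (bss , bss! , Pbss , 5/8≤) = event ,
  ≤-trans (/*≤⇒*≤* 5 7 (2 ^ k) (length bss) 5/8≤)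
    (*-monoʳ-≤ 8 (≤-trans (length≤∑∈ bss bss!) (∑-mono indicator≤occupied)))
  where
  event : ∀ bs → Maybe (P bs)
  event bs with bs ∈ᵛ? bss
  ... | yes bs∈ = just (All.lookup Pbss bs∈)
  ... | no _    = nothing

  indicator≤occupied : ∀ bs → indicator (bs ∈ᵛ? bss) ℕ.≤ occupied (event bs)
  indicator≤occupied bs with bs ∈ᵛ? bss
  ... | yes _ = ≤-refl
  ... | no _  = z≤n

-- Runs of one algorithm on several graphs

module _ {o} {Out : Set o} (A : Algorithm Out) {n} (G : Graph n) where

  -- A run that has halted reads no further bits, so its output survives when more bits are
  -- supplied.
  outputFrom-truncate : ∀ {j k x} (j≤k : j ℕ.≤ k) h (bs : Vec Bool k) →
    outputFrom A G h (truncate j≤k bs) ≡ just x → outputFrom A G h bs ≡ just x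
  outputFrom-truncate z≤n h bs eq with A n h
  outputFrom-truncate z≤n h bs eq | halt x = eq
  outputFrom-truncate z≤n h bs () | ask r
  outputFrom-truncate (s≤s j≤k) h (b ∷ bs) eq with A n h
  ... | halt x = eq
  ... | ask r  = outputFrom-truncate j≤k _ bs eq

  -- With `cost` as weight this is `oneStepOpsFrom`; with a separation weight it counts the requests
  -- made on `G` that might reveal another graph.
  weightFrom : ∀ {k} → (Request n → ℕ) → History n → Vec Bool k → ℕ
  weightFrom w h [] = 0
  weightFrom w h (b ∷ bs) with A n h
  ... | halt x = 0
  ... | ask r  = w r + weightFrom w (answer G b r ∷ h) bs

  -- All the weights are summed along the same run on `G`, so the bound for a single request adds up
  -- over its requests.
  sum-weightFrom : ∀ {m k} (w : Fin m → Request n → ℕ) c →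
    (∀ r → sum (λ i → w i r) ℕ.≤ c * cost r) → ∀ h (bs : Vec Bool k) →
    sum (λ i → weightFrom (w i) h bs) ℕ.≤ c * oneStepOpsFrom A G h bs
  sum-weightFrom {m} w c w≤ h [] = ≤-trans (≤-reflexive (sum-replicate-zero m)) z≤n
  sum-weightFrom {m} w c w≤ h (b ∷ bs) with A n h
  ... | halt x = ≤-trans (≤-reflexive (sum-replicate-zero m)) z≤n
  ... | ask r  = ≤-trans
    (≤-reflexive (∑-distrib-+ (λ i → w i r) _))
    (≤-trans (+-mono-≤ (w≤ r) (sum-weightFrom w c w≤ _ bs))
      (≤-reflexive (sym (ℕ.*-distribˡ-+ c (cost r) _))))

  -- As long as no request has positive weight, both graphs give the same answers; the histories
  -- stay equal, and so does the next action.
  outputFrom-agree : (H : Graph n) (w : Request n → ℕ) →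
    (∀ r → w r ≡ 0 → ∀ b → answer G b r ≡ answer H b r) →
    ∀ {k} h (bs : Vec Bool k) → weightFrom w h bs ≡ 0 →
    outputFrom A G h bs ≡ outputFrom A H h bs
  outputFrom-agree H w detects h [] _ with A n h
  ... | halt x = refl
  ... | ask r  = refl
  outputFrom-agree H w detects h (b ∷ bs) eq with A n h
  ... | halt x = refl
  ... | ask r  rewrite sym (detects r (ℕ.m+n≡0⇒m≡0 (w r) eq) b) =
    outputFrom-agree H w detects _ bs (ℕ.m+n≡0⇒n≡0 (w r) eq)

  -- w i r > 0 marks the requests r that may separate G from H i.
  separation-bound : ∀ {m} (H : Fin m → Graph n) (w : Fin m → Request n → ℕ) c →
    (∀ i r → w i r ≡ 0 → ∀ b → answer G b r ≡ answer (H i) b r) →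
    (∀ r → sum (λ i → w i r) ℕ.≤ c * cost r) →
    ∀ {p} (P : Maybe Out → Set p) (Q : Fin m → Maybe Out → Set p) →
    (∀ i x → P x → ¬ Q i x) →
    ∀ k → Likely k (P ∘ output A G) → (∀ i → Likely k (Q i ∘ output A (H i))) →
    ∃[ bs ] m ℕ.≤ 4 * c * oneStepOps A G {k} bs
  separation-bound {m} H w c detects w≤ P Q disjoint k (good , 5/8≤G) likelyQ =
    averaging m (4 * c) (oneStepOps A G) total
    where
    hits : Fin m → Vec Bool k → ℕ
    hits i = weightFrom (w i) []

    -- The quarter arises as 5/8 + 5/8 - 1: the premises give `10 T ≤ 8 (T + z)`, that is
    -- `2 T ≤ 8 z`.
    union-bound : ∀ {T x y z} → 5 * T ℕ.≤ 8 * x → 5 * T ℕ.≤ 8 * y → x + y ℕ.≤ T + z → T ℕ.≤ 4 * z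
    union-bound {T} {x} {y} {z} p q r = ℕ.*-cancelˡ-≤ 2 (ℕ.+-cancelˡ-≤ (8 * T) _ _
      (subst₂ ℕ._≤_
        (solve 1 (λ T → con 5 :* T :+ con 5 :* T := con 8 :* T :+ con 2 :* T) refl T)
        (solve 2 (λ T z → con 8 :* (T :+ z) := con 8 :* T :+ con 2 :* (con 4 :* z)) refl T z)
        (≤-trans (+-mono-≤ p q)
          (≤-trans (≤-reflexive (sym (ℕ.*-distribˡ-+ 8 x y))) (*-monoʳ-≤ 8 r)))))
      where open +-*-Solver

    many-hits : ∀ i → 2 ^ k ℕ.≤ 4 * ∑ (hits i)
    many-hits i with likelyQ i
    ... | good′ , 5/8≤H = union-bound {x = ∑ (occupied ∘ good)} 5/8≤G 5/8≤H
      (subst₂ ℕ._≤_ (∑-+ (occupied ∘ good) (occupied ∘ good′))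
        (trans (∑-+ (const 1) (hits i)) (cong (_+ ∑ (hits i)) (∑-const1 k)))
        (∑-mono pointwise))
      where
      -- A string that is good for both graphs must cause a hit: without one the two outputs
      -- coincide, which `disjoint` forbids.
      pointwise : ∀ bs → occupied (good bs) + occupied (good′ bs) ℕ.≤ 1 + hits i bs
      pointwise bs with good bs | good′ bs | hits i bs in eq
      ... | nothing | nothing | _     = z≤n
      ... | nothing | just _  | _     = s≤s z≤n
      ... | just _  | nothing | _     = s≤s z≤n
      ... | just _  | just _  | suc _ = s≤s (s≤s z≤n)
      ... | just p  | just q  | zero  = ⊥-elim (disjoint i _
        (subst P (outputFrom-agree (H i) (w i) (detects i) [] bs eq) p) q)

    open ℕ.≤-Reasoning

    ops : Vec Bool k → ℕ
    ops = oneStepOps A G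

    -- Double counting of hits: first by graph, where each `H i` collects at least `2 ^ k / 4`, then
    -- by string, where a run collects at most `c` per operation.
    total : m * 2 ^ k ℕ.≤ 4 * c * ∑ ops
    total = begin
      m * 2 ^ k                            ≤⟨ sum-bounded-below (2 ^ k) 4 _ many-hits ⟩
      4 * sum (λ i → ∑ (hits i))           ≡⟨ cong (4 *_) (sum-∑-comm hits) ⟩
      4 * ∑ (λ bs → sum (λ i → hits i bs)) ≤⟨ *-monoʳ-≤ 4 (∑-mono {k} (sum-weightFrom w c w≤ [])) ⟩
      4 * ∑ (λ bs → c * ops bs)            ≡⟨ cong (4 *_) (∑-* c ops) ⟩
      4 * (c * ∑ ops)                      ≡⟨ ℕ.*-assoc 4 c (∑ ops) ⟨
      4 * c * ∑ ops                        ∎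

module _ {c ℓ₁ ℓ₂} (R : OrderedField c ℓ₁ ℓ₂) (ρ : OrderedField.Carrier R)
  (1≤ρ : OrderedField._≤_ R (OrderedField.1# R) ρ)
  (A : Algorithm (OrderedField.Carrier R)) where

  -- Both modes of correctness lead to the same kind of event. It is given for every sufficiently
  -- large `k`, so that different graphs can share one run length.
  eventually-likely : ApproximatesDiameter R ρ 1≤ρ A →
    ∀ {n} (G : Graph n) → Undirected G → Connected G →
    ∃[ K ] (∀ k → K ℕ.≤ k → Likely k (λ bs → Correct R ρ 1≤ρ G (output A G bs)))
  eventually-likely (inj₁ (_ , correct)) {n} G G-sym G-conn
    with correct n G G-sym G-conn
  ... | K , always = K , λ k K≤k → always⇒likely λ bs →
    let D̃ , eq , approx = always (truncate K≤k bs)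
    in D̃ , outputFrom-truncate A G K≤k [] bs eq , approx
  eventually-likely (inj₂ correct) {n} G G-sym G-conn
    -- The slack 1/24 leaves 2/3 - 1/24 = 5/8, still above 1/2, so two such events must overlap.
    with correct n G G-sym G-conn (+ 1 ℚ./ 24) (ℚ.positive⁻¹ _)
  ... | K , bounded = K , λ k K≤k → probability⇒likely (bounded k K≤k)

-- Graphs

-- With the loops, a query to any nonempty set returns all vertices.
complete : ∀ n → Graph n
complete n = record { E = λ _ _ → ⊤ ; E? = λ _ _ → yes tt }

complete-connected : Connected (complete n)
complete-connected u v = 1 , step tt done

no-walk-of-length-0 : {G : Graph n} {u v : Fin n} → u ≢ v → ¬ Walk G 0 u v
no-walk-of-length-0 u≢u done = u≢u refl

complete-diameter : {u v : Fin n} → u ≢ v → IsDiameter (complete n) 1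
complete-diameter {n} {u} {v} u≢v =
  (u , v , step tt done , λ where
    zero    walk → contradiction walk (no-walk-of-length-0 u≢v)
    (suc _) _    → s≤s z≤n) ,
  λ _ _ _ (_ , shortest) → shortest 1 (step tt done)

Endpoints : (a b u v : Fin n) → Set
Endpoints a b u v = (u ≡ a × v ≡ b) ⊎ (u ≡ b × v ≡ a)

endpoints? : ∀ (a b u v : Fin n) → Dec (Endpoints a b u v)
endpoints? a b u v =
  ((u Fin.≟ a) ×-dec (v Fin.≟ b)) ⊎-dec ((u Fin.≟ b) ×-dec (v Fin.≟ a))

endpoints-sym : {a b u v : Fin n} → Endpoints a b u v → Endpoints a b v u
endpoints-sym (inj₁ (u≡a , v≡b)) = inj₂ (v≡b , u≡a)
endpoints-sym (inj₂ (u≡b , v≡a)) = inj₁ (v≡a , u≡b)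

completeWithout : (a b : Fin n) → Graph n
completeWithout a b = record
  { E  = λ u v → ¬ Endpoints a b u v
  ; E? = λ u v → ¬? (endpoints? a b u v)
  }

completeWithout-undirected : (a b : Fin n) → Undirected (completeWithout a b)
completeWithout-undirected a b uv = uv ∘ endpoints-sym

module _ {a b w : Fin n} (w≢a : w ≢ a) (w≢b : w ≢ b) where

  -- No edge at `w` is deleted, its loop included, so `u` and `v` may be arbitrary, even equal to
  -- `w`.
  walk-via-third : ∀ u v → Walk (completeWithout a b) 2 u v
  walk-via-third u v = step u-w (step w-v done)
    where
    w-v : ¬ Endpoints a b w v
    w-v = [ w≢a ∘ proj₁ , w≢b ∘ proj₁ ]′

    u-w : ¬ Endpoints a b u w
    u-w = [ w≢b ∘ proj₂ , w≢a ∘ proj₂ ]′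

  completeWithout-connected : Connected (completeWithout a b)
  completeWithout-connected u v = 2 , walk-via-third u v

  completeWithout-diameter : a ≢ b → IsDiameter (completeWithout a b) 2
  completeWithout-diameter a≢b =
    (a , b , walk-via-third a b , λ where
      zero          walk            → contradiction walk (no-walk-of-length-0 a≢b)
      (suc zero)    (step a-b done) → contradiction (inj₁ (refl , refl)) a-b
      (suc (suc _)) _               → s≤s (s≤s z≤n)) ,
    λ u v _ (_ , shortest) → shortest 2 (walk-via-third u v)

Pre≡Post : {G : Graph n} → Undirected G → ∀ S → Pre G S ≡ Post G S
Pre≡Post {G = G} G-sym S = tabulate-cong λ v → does-⇔
  (mk⇔ (λ (s , s∈S , vs) → s , s∈S , G-sym vs) (λ (s , s∈S , sv) → s , s∈S , G-sym sv))
  (any? λ s → (s ∈? S) ×-dec E? G v s) (any? λ s → (s ∈? S) ×-dec E? G s v)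

another-element : {S : Subset n} {s : Fin n} → s ∈ S → ∀ x → S ≢ ⁅ x ⁆ →
  ∃[ t ] t ∈ S × t ≢ x
another-element {S = S} {s} s∈S x S≢⁅x⁆ with any? (λ t → (t ∈? S) ×-dec ¬? (t Fin.≟ x))
... | yes found = found
... | no ¬found = contradiction
  (⊆-antisym (λ t∈S → subst (_∈ ⁅ x ⁆) (sym (only-x t∈S)) (x∈⁅x⁆ x))
             (λ t∈⁅x⁆ → subst (_∈ S) (trans (only-x s∈S) (sym (x∈⁅y⁆⇒x≡y x t∈⁅x⁆))) s∈S))
  S≢⁅x⁆
  where
  only-x : ∀ {t} → t ∈ S → t ≡ x
  only-x {t} t∈S with t Fin.≟ x
  ... | yes t≡x = t≡x
  ... | no t≢x  = contradiction (t , t∈S , t≢x) ¬found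

-- Only `a` and `b` lose a neighbour, namely each other. So `a` drops out of the answer to a
-- nonempty `S` only if `b` is the sole element of `S`, and vice versa.
Post-completeWithout : {a b : Fin n} → a ≢ b → ∀ S → S ≢ ⁅ a ⁆ → S ≢ ⁅ b ⁆ →
  Post (complete n) S ≡ Post (completeWithout a b) S
Post-completeWithout {n} {a} {b} a≢b S S≢⁅a⁆ S≢⁅b⁆ = tabulate-cong λ v → does-⇔
  (mk⇔ (λ (s , s∈S , _) → neighbour v s∈S) (λ (s , s∈S , _) → s , s∈S , tt))
  (any? λ s → (s ∈? S) ×-dec E? (complete n) s v)
  (any? λ s → (s ∈? S) ×-dec E? (completeWithout a b) s v)
  where
  neighbour : ∀ v {s} → s ∈ S → ∃[ t ] t ∈ S × ¬ Endpoints a b t v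
  neighbour v {s} s∈S with v Fin.≟ a | v Fin.≟ b
  ... | yes refl | _ =
    let t , t∈S , t≢b = another-element s∈S b S≢⁅b⁆
    in t , t∈S , [ a≢b ∘ proj₂ , t≢b ∘ proj₁ ]′
  ... | no _ | yes refl =
    let t , t∈S , t≢a = another-element s∈S a S≢⁅a⁆
    in t , t∈S , [ t≢a ∘ proj₁ , a≢b ∘ sym ∘ proj₂ ]′
  ... | no v≢a | no v≢b = s , s∈S , [ v≢b ∘ proj₂ , v≢a ∘ proj₂ ]′

-- A sum of two indicators instead of a disjunction, so that the sum over all deleted edges splits
-- into one sum per endpoint.
isSingleton : (a b : Fin n) → Request n → ℕ
isSingleton a b (pre S)  = indicator (S ≟ᵛ ⁅ a ⁆) + indicator (S ≟ᵛ ⁅ b ⁆)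
isSingleton a b (post S) = indicator (S ≟ᵛ ⁅ a ⁆) + indicator (S ≟ᵛ ⁅ b ⁆)
isSingleton a b toss     = 0

isSingleton-detects : {a b : Fin n} → a ≢ b → ∀ r → isSingleton a b r ≡ 0 →
  ∀ c → answer (complete n) c r ≡ answer (completeWithout a b) c r
isSingleton-detects {n} {a} {b} a≢b = λ where
    (pre S)  eq _ → cong inj₁ (trans (Pre≡Post {G = complete n} _ S)
      (trans (same S eq) (sym (Pre≡Post (completeWithout-undirected a b) S))))
    (post S) eq _ → cong inj₁ (same S eq)
    toss     _  _ → refl
  where
  same : ∀ S → indicator (S ≟ᵛ ⁅ a ⁆) + indicator (S ≟ᵛ ⁅ b ⁆) ≡ 0 →
    Post (complete n) S ≡ Post (completeWithout a b) S
  same S eq = Post-completeWithout a≢b S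
    (indicator≡0⇒¬ (S ≟ᵛ ⁅ a ⁆) (ℕ.m+n≡0⇒m≡0 (indicator (S ≟ᵛ ⁅ a ⁆)) eq))
    (indicator≡0⇒¬ (S ≟ᵛ ⁅ b ⁆) (ℕ.m+n≡0⇒n≡0 (indicator (S ≟ᵛ ⁅ a ⁆)) eq))

-- A set is the singleton of at most one vertex, and by injectivity that vertex is `f i` for at most
-- one `i` and `g i` for at most one `i`.
sum-isSingleton : (f g : Fin m → Fin n) →
  (∀ {i j} → f i ≡ f j → i ≡ j) → (∀ {i j} → g i ≡ g j → i ≡ j) →
  ∀ r → sum (λ i → isSingleton (f i) (g i) r) ℕ.≤ 2 * cost r
sum-isSingleton {m} {n} f g f-inj g-inj = λ where
    (pre S)  → at-most-2 S
    (post S) → at-most-2 S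
    toss     → ≤-reflexive (sum-replicate-zero m)
  where
  at-most-1 : (h : Fin m → Fin n) → (∀ {i j} → h i ≡ h j → i ≡ j) →
    ∀ S → sum (λ i → indicator (S ≟ᵛ ⁅ h i ⁆)) ℕ.≤ 1
  at-most-1 h h-inj S = sum-indicator≤1 (λ i → S ≟ᵛ ⁅ h i ⁆) λ i j S≡⁅hi⁆ S≡⁅hj⁆ →
    h-inj (x∈⁅y⁆⇒x≡y (h j) (subst (h i ∈_) (trans (sym S≡⁅hi⁆) S≡⁅hj⁆) (x∈⁅x⁆ (h i))))

  at-most-2 : ∀ S →
    sum (λ i → indicator (S ≟ᵛ ⁅ f i ⁆) + indicator (S ≟ᵛ ⁅ g i ⁆)) ℕ.≤ 2
  at-most-2 S = ≤-trans (≤-reflexive (∑-distrib-+ {m} _ _))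
    (+-mono-≤ (at-most-1 f f-inj S) (at-most-1 g g-inj S))

-- The Hamiltonian path and the lower bound

inject₁≢suc : (i : Fin m) → inject₁ i ≢ suc i
inject₁≢suc (suc i) = inject₁≢suc i ∘ suc-injective

-- The path edge `i` joins `inject₁ i` and `suc i`. Vertex 2 avoids the first edge, and vertex 0
-- avoids all later ones; this takes at least three vertices.
third-vertex : (i : Fin (2 + m)) → ∃[ w ] w ≢ inject₁ i × w ≢ suc i
third-vertex zero    = suc (suc zero) , (λ ()) , (λ ())
third-vertex (suc i) = zero , (λ ()) , (λ ())

module _ {c ℓ₁ ℓ₂} (R : OrderedField c ℓ₁ ℓ₂) (ρ : OrderedField.Carrier R)
  (1≤ρ : OrderedField._≤_ R (OrderedField.1# R) ρ)
  (ρ<2 : OrderedField._<_ R ρ (OrderedField.fromℕ R 2))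
  (A : Algorithm (OrderedField.Carrier R)) (approximates : ApproximatesDiameter R ρ 1≤ρ A) where

  many-queries : ∀ N → ∃[ k ] Σ[ bs ∈ Vec Bool k ]
    2 + N ℕ.≤ 8 * oneStepOps A (complete (3 + N)) bs
  many-queries N = K , separation-bound A (complete (3 + N)) G
    -- A vertex lies on at most two path edges, hence `c = 2` and the factor `4 * 2 = 8`.
    (λ i → isSingleton (inject₁ i) (suc i)) 2
    (λ i → isSingleton-detects (inject₁≢suc i))
    (sum-isSingleton inject₁ suc inject₁-injective suc-injective)
    (Correct R ρ 1≤ρ (complete (3 + N))) (λ i → Correct R ρ 1≤ρ (G i)) disjoint
    K (proj₂ likely₀ K (ℕ.m≤m⊔n (proj₁ likely₀) (proj₁ K₁)))
    (λ i → proj₂ (likelyᵢ i) K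
      (≤-trans (proj₂ K₁ i) (ℕ.m≤n⊔m (proj₁ likely₀) (proj₁ K₁))))
    where
    G : Fin (2 + N) → Graph (3 + N)
    G i = completeWithout (inject₁ i) (suc i)

    disjoint : ∀ i x → Correct R ρ 1≤ρ (complete (3 + N)) x → ¬ Correct R ρ 1≤ρ (G i) x
    disjoint i x (_ , refl , approx₁) (_ , refl , approx₂) with third-vertex i
    ... | w , w≢a , w≢b = OrderedFieldProperties.diameters-1-2-separated R 1≤ρ ρ<2
      (approx₁ 1 (complete-diameter (inject₁≢suc i)))
      (approx₂ 2 (completeWithout-diameter w≢a w≢b (inject₁≢suc i)))

    likely₀ = eventually-likely R ρ 1≤ρ A approximates
      (complete (3 + N)) (λ _ → tt) complete-connected

    likelyᵢ = λ i → let w , w≢a , w≢b = third-vertex i in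
      eventually-likely R ρ 1≤ρ A approximates (G i)
        (completeWithout-undirected (inject₁ i) (suc i)) (completeWithout-connected w≢a w≢b)

    K₁ = upper-bound (proj₁ ∘ likelyᵢ)
    -- One length for all graphs, since the runs are compared on the same random strings.
    K  = proj₁ likely₀ ℕ.⊔ proj₁ K₁

theorem3p15 : ∀ {c ℓ₁ ℓ₂} (R : OrderedField c ℓ₁ ℓ₂) → let open OrderedField R in
    (ε : Carrier) → 0# < ε → (1≤3/2-ε : 1# ≤ 3/2 - ε) →
    Σ[ c′ ∈ ℚ ] 0ℚ ℚ.< c′ ×
    ((A : Algorithm Carrier) → ApproximatesDiameter R (3/2 - ε) 1≤3/2-ε A →
    ∀ (N : ℕ) → ∃[ n ] N ℕ.≤ n × (Σ[ G ∈ Graph n ] Undirected G × Connected G ×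
    (∃[ k ] Σ[ bs ∈ Vec Bool k ]
    c′ ℚ.* fromℕℚ n ℚ.≤ fromℕℚ (oneStepOps A G bs))))
theorem3p15 R ε 0<ε 1≤ρ = + 1 ℚ./ 16 , ℚ.positive⁻¹ _ , λ A approximates N →
  let k , bs , N+2≤8*ops = many-queries R _ 1≤ρ (3/2-ε<2 0<ε) A approximates N
      ops = oneStepOps A (complete (3 + N)) bs
  in 3 + N , ℕ.m≤n+m N 3 , complete (3 + N) , (λ _ → tt) , complete-connected , k , bs ,
    *≤*⇒/*≤ 1 15 (3 + N) ops (double {N} {ops} N+2≤8*ops)
  where
  open OrderedFieldProperties R using (3/2-ε<2)

  -- The number `3 + m` of vertices is at most twice the number `2 + m` of path edges, which turns
  -- the factor 8 into 16.
  double : ∀ {m x} → 2 + m ℕ.≤ 8 * x → 1 * (3 + m) ℕ.≤ 16 * x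
  double {m} {x} le = ≤-trans
    (subst₂ ℕ._≤_ (solve 1 (λ m → con 3 :+ m := con 1 :* (con 3 :+ m)) refl m)
      (solve 1 (λ m → con 3 :+ m :+ (con 1 :+ m) := con 2 :* (con 2 :+ m)) refl m)
      (ℕ.m≤m+n (3 + m) (1 + m)))
    (≤-trans (*-monoʳ-≤ 2 le) (≤-reflexive (sym (ℕ.*-assoc 2 8 x))))
    where open +-*-Solver
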